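{- Let $\Gamma$ be a connected vertex-transitive digraph such that the in-valency and the out-valency are both $2$, and set $G=\mathrm{Aut}(\Gamma)$. If $\Gamma$ is not highly-arc-transitive, then there is a non-negative integer $k$ such that $G$ acts regularly on the $k$-arcs of $\Gamma$ and $|G_v|=2^k$ for every vertex $v$ of $\Gamma$. In particular, if the vertex stabilizers in $\mathrm{Aut}(\Gamma)$ are infinite, then $\Gamma$ is highly-arc-transitive.
   Context: A digraph $\Gamma=(V\Gamma,E\Gamma)$ has vertex set $V\Gamma$ and arc set $E\Gamma\subseteq V\Gamma\times V\Gamma$. It is connected if its underlying undirected graph is connected. The in-valency (out-valency) of a vertex $v$ is the number of vertices $u$ with $(u,v)\in E\Gamma$ (respectively $(v,u)\in E\Gamma$). A $k$-arc is a sequence of vertices $v_0,\dots,v_k$ with $(v_i,v_{i+1})\in E\Gamma$ for $0\le i<k$ (a 0-arc is a vertex). $\Gamma$ is vertex-transitive if $\mathrm{Aut}(\Gamma)$ is transitive on vertices, $k$-arc-transitive if $\mathrm{Aut}(\Gamma)$ is transitive on $k$-arcs, and highly-arc-transitive if it is $k$-arc-transitive for all $k$. A group acts regularly on a set if it acts transitively and the stabilizer of each point is trivial. $G_v$ is the stabilizer of $v$ in $G$. -}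

module Defs where

open import Algebra.Bundles using (Group)
open import Data.Fin.Base using (Fin; suc; inject₁)
open import Data.Nat.Base using (ℕ; suc)
open import Data.Product.Base using (_×_; _,_; ∃; proj₁)
open import Data.Vec.Functional using (Vector; map)
import Data.Vec.Functional.Relation.Binary.Equality.Setoid as VecEquality
open import Function.Bundles using (_↔_; _⇔_; Inverse; Equivalence; mk⇔)
open import Function.Construct.Composition using (_↔-∘_; _⇔-∘_)
open import Function.Construct.Identity using (↔-id; ⇔-id)
open import Function.Construct.Symmetry using (↔-sym)
open import Level using (Level; _⊔_) renaming (suc to lsuc)
open import Relation.Binary.Bundles using (Setoid)
open import Relation.Binary.Core using (Rel)
open import Relation.Binary.Construct.Closure.Equivalence using (EqClosure)
import Relation.Binary.Construct.On as On
open import Relation.Binary.PropositionalEquality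
  using (_≡_; refl; sym; trans; cong; subst₂; setoid)
open import Relation.Nullary.Negation using (¬_)
open import Relation.Unary using (Pred)

private
  variable
    a b c p ℓ : Level

-- Elements of the subset are compared by their underlying elements only, so
-- membership proofs never contribute to cardinalities.
Subsetoid : (X : Setoid a ℓ) → Pred (Setoid.Carrier X) p → Setoid (a ⊔ p) ℓ
Subsetoid X P = On.setoid X (proj₁ {B = P})

HasCardinality : Setoid a ℓ → ℕ → Set (a ⊔ ℓ)
HasCardinality X n = Inverse X (setoid (Fin n))

Finite : Setoid a ℓ → Set (a ⊔ ℓ)
Finite X = ∃ (HasCardinality X)

Infinite : Setoid a ℓ → Set (a ⊔ ℓ)
Infinite X = ¬ Finite X

record Action (G : Group a b) (X : Setoid c ℓ) : Set (a ⊔ b ⊔ c ⊔ ℓ) where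
  private
    module G = Group G
    module X = Setoid X
  infixr 7 _·_
  field
    _·_    : G.Carrier → X.Carrier → X.Carrier
    ·-cong : ∀ {g h x y} → g G.≈ h → x X.≈ y → g · x X.≈ h · y
    ε·     : ∀ x → G.ε · x X.≈ x
    ∙·     : ∀ g h x → (g G.∙ h) · x X.≈ g · (h · x)

  Transitive : Set (a ⊔ c ⊔ ℓ)
  Transitive = ∀ x y → ∃ λ g → g · x X.≈ y

  Stabilizer : X.Carrier → Setoid (a ⊔ ℓ) b
  Stabilizer x = Subsetoid G.setoid (λ g → g · x X.≈ x)

  TrivialStabilizers : Set (a ⊔ b ⊔ c ⊔ ℓ)
  TrivialStabilizers = ∀ x g → g · x X.≈ x → g G.≈ G.ε

  Regular : Set (a ⊔ b ⊔ c ⊔ ℓ)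
  Regular = Transitive × TrivialStabilizers

record Digraph (a ℓ : Level) : Set (lsuc (a ⊔ ℓ)) where
  field
    V : Set a
    E : Rel V ℓ

module _ (Γ : Digraph a ℓ) where
  open Digraph Γ

  Connected : Set (a ⊔ ℓ)
  Connected = ∀ u v → EqClosure E u v

  InValency : V → ℕ → Set (a ⊔ ℓ)
  InValency v = HasCardinality (Subsetoid (setoid V) (λ u → E u v))

  OutValency : V → ℕ → Set (a ⊔ ℓ)
  OutValency v = HasCardinality (Subsetoid (setoid V) (λ u → E v u))

  IsArc : ∀ k → Vector V (suc k) → Set ℓ
  IsArc k x = ∀ (i : Fin k) → E (x (inject₁ i)) (x (suc i))

  Arcs : ℕ → Setoid (a ⊔ ℓ) a
  Arcs k = Subsetoid (VecEquality.≋-setoid (setoid V) (suc k)) (IsArc k)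

  record Automorphism : Set (a ⊔ ℓ) where
    field
      perm  : V ↔ V
    open Inverse perm public using (to; from; strictlyInverseˡ; strictlyInverseʳ)
    field
      arc-⇔ : ∀ u v → E u v ⇔ E (to u) (to v)

  private
    open module A = Automorphism using (to; from)

    idAut : Automorphism
    idAut = record { perm = ↔-id V ; arc-⇔ = λ u v → ⇔-id (E u v) }

    _∘Aut_ : Automorphism → Automorphism → Automorphism
    g ∘Aut h = record
      { perm  = A.perm g ↔-∘ A.perm h
      ; arc-⇔ = λ u v → A.arc-⇔ g (to h u) (to h v) ⇔-∘ A.arc-⇔ h u v
      }

    invAut : Automorphism → Automorphism
    invAut g = record
      { perm  = ↔-sym (A.perm g)
      ; arc-⇔ = λ u v → mk⇔
          (λ e → Equivalence.from (A.arc-⇔ g (from g u) (from g v))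
                   (subst₂ E (sym (A.strictlyInverseˡ g u)) (sym (A.strictlyInverseˡ g v)) e))
          (λ e → subst₂ E (A.strictlyInverseˡ g u) (A.strictlyInverseˡ g v)
                   (Equivalence.to (A.arc-⇔ g (from g u) (from g v)) e))
      }

  Aut : Group (a ⊔ ℓ) a
  Aut = record
    { Carrier = Automorphism
    ; _≈_     = λ g h → ∀ v → to g v ≡ to h v
    ; _∙_     = _∘Aut_
    ; ε       = idAut
    ; _⁻¹     = invAut
    ; isGroup = record
      { isMonoid = record
        { isSemigroup = record
          { isMagma = record
            { isEquivalence = record
              { refl  = λ v → refl
              ; sym   = λ p v → sym (p v)
              ; trans = λ p q v → trans (p v) (q v)
              }
            ; ∙-cong = λ {g} {g′} {h} {h′} p q v → trans (cong (to g) (q v)) (p (to h′ v))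
            }
          ; assoc = λ f g h v → refl
          }
        ; identity = (λ g v → refl) , (λ g v → refl)
        }
      ; inverse = A.strictlyInverseʳ , A.strictlyInverseˡ
      ; ⁻¹-cong = λ {g} {h} p v →
          trans (cong (from g) (sym (trans (p (from h v)) (A.strictlyInverseˡ h v))))
                (A.strictlyInverseʳ g (from h v))
      }
    }

  vertexAction : Action Aut (setoid V)
  vertexAction = record
    { _·_    = to
    ; ·-cong = λ {g} {h} {x} {y} p q → trans (cong (to g) q) (p y)
    ; ε·     = λ x → refl
    ; ∙·     = λ g h x → refl
    }

  arcAction : ∀ k → Action Aut (Arcs k)
  arcAction k = record
    { _·_    = λ g (x , arc) → map (to g) x ,
                 λ i → Equivalence.to (A.arc-⇔ g (x (inject₁ i)) (x (suc i))) (arc i)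
    ; ·-cong = λ {g} {h} {x} {y} p q i → trans (cong (to g) (q i)) (p (proj₁ y i))
    ; ε·     = λ x i → refl
    ; ∙·     = λ g h x i → refl
    }

  VertexTransitive : Set (a ⊔ ℓ)
  VertexTransitive = Action.Transitive vertexAction

  VertexStabilizer : V → Setoid (a ⊔ ℓ) a
  VertexStabilizer = Action.Stabilizer vertexAction

  ArcTransitive : ℕ → Set (a ⊔ ℓ)
  ArcTransitive k = Action.Transitive (arcAction k)

  ArcRegular : ℕ → Set (a ⊔ ℓ)
  ArcRegular k = Action.Regular (arcAction k)

  HighlyArcTransitive : Set (a ⊔ ℓ)
  HighlyArcTransitive = ∀ k → ArcTransitive k

{-# OPTIONS --safe #-}

-- Take k such that G is transitive on k-arcs but not on (k+1)-arcs. As each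
-- k-arc has exactly two extensions at either end, an automorphism that fixes a
-- k-arc and moves one of its extensions would make G transitive on (k+1)-arcs.
-- So an automorphism that fixes a k-arc fixes all its extensions at both ends,
-- hence all the k-arcs obtained by shifting it forwards or backwards one step
-- at a time; as Γ is connected, these shifts reach every vertex. Thus G is
-- regular on k-arcs, and G_v is in bijection with the 2 ^ k k-arcs starting at v.
module Submission where

open import Defs
open import Algebra.Bundles using (Group)
import Algebra.Properties.Group as GroupProperties
open import Axiom.DoubleNegationElimination using (em⇒dne)
open import Axiom.ExcludedMiddle using (ExcludedMiddle)
open import Data.Fin.Base using (Fin; zero; suc; inject₁; fromℕ; funToFin; finToFun; combine)
open import Data.Fin.Induction using (<-weakInduction; >-weakInduction)
open import Data.Fin.Properties using (funToFin-finToFin; finToFun-funToFin)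
open import Data.Fin.Relation.Unary.Top using (view; ‵fromℕ; ‵inject₁)
open import Data.Nat.Base using (ℕ; zero; suc; _^_)
open import Data.Product.Base using (_×_; _,_; ∃; proj₁; proj₂)
open import Data.Vec.Functional using (Vector; _∷_; head; tail; init; last; insertAt)
open import Data.Vec.Functional.Properties using (insertAt-lookup)
open import Data.Vec.Functional.Relation.Binary.Equality.Setoid using (≋-setoid)
open import Function.Base using (_∘_)
open import Function.Bundles using (Func; Inverse; Injection)
import Function.Construct.Composition as Compose
open import Function.Properties.Inverse using (Inverse⇒Injection)
open import Level using (Level; _⊔_; Lift; lift; lower)
open import Relation.Binary.Bundles using (Setoid)
open import Relation.Binary.Construct.Closure.Equivalence using (EqClosure)
open import Relation.Binary.Construct.Closure.ReflexiveTransitive using (ε; _◅_)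
open import Relation.Binary.Construct.Closure.Symmetric using (fwd; bwd)
open import Relation.Binary.Definitions using (Decidable)
open import Relation.Binary.PropositionalEquality
  using (_≡_; _≢_; _≗_; refl; sym; trans; cong; cong₂; subst; setoid)
import Relation.Binary.Reasoning.Setoid as SetoidReasoning
open import Relation.Nullary.Decidable using (yes; no; map′)
open import Relation.Nullary.Negation using (¬_; contradiction)

private
  variable
    a b c d ℓ ℓ′ p : Level

-- Phrased as a cancellation rule: from two inequalities with a common point it returns an equation,
-- which is how the fibres below are exploited.
AtMostTwo : (X : Setoid c ℓ) → (Setoid.Carrier X → Set p) → Set (c ⊔ ℓ ⊔ p)
AtMostTwo X P = ∀ {x y z} → P x → P y → P z → ¬ x ≈ y → ¬ x ≈ z → y ≈ z
  where open Setoid X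

cardinality-2⇒AtMostTwo : {X : Setoid c ℓ} {P : Setoid.Carrier X → Set p} →
  HasCardinality (Subsetoid X P) 2 → AtMostTwo X P
cardinality-2⇒AtMostTwo f {x} {y} {z} px py pz x≉y x≉z =
  injective (two (to (x , px)) (to (y , py)) (to (z , pz)) (x≉y ∘ injective) (x≉z ∘ injective))
  where
  open Injection (Inverse⇒Injection f) using (to; injective)

  two : (i j l : Fin 2) → i ≢ j → i ≢ l → j ≡ l
  two zero       zero       l          i≢j i≢l = contradiction refl i≢j
  two zero       (suc zero) zero       i≢j i≢l = contradiction refl i≢l
  two zero       (suc zero) (suc zero) i≢j i≢l = refl
  two (suc zero) zero       zero       i≢j i≢l = refl
  two (suc zero) zero       (suc zero) i≢j i≢l = contradiction refl i≢l
  two (suc zero) (suc zero) l          i≢j i≢l = contradiction refl i≢j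

-- Cancellation in group actions.

module ActionProperties {G : Group a b} {X : Setoid c ℓ} (A : Action G X) where
  open Group G using (_∙_; _⁻¹; inverseˡ) renaming (_≈_ to _≈ᴳ_; refl to reflᴳ)
  open GroupProperties G using (inverseʳ-unique; ⁻¹-involutive)
  open Setoid X using (_≈_)
  private module X = Setoid X
  open Action A
  open SetoidReasoning X

  ·-congˡ : ∀ g {x y} → x ≈ y → g · x ≈ g · y
  ·-congˡ g = ·-cong reflᴳ

  ⁻¹·· : ∀ g x → (g ⁻¹) · (g · x) ≈ x
  ⁻¹·· g x = begin
    (g ⁻¹) · (g · x)  ≈⟨ ∙· (g ⁻¹) g x ⟨
    (g ⁻¹ ∙ g) · x    ≈⟨ ·-cong (inverseˡ g) X.refl ⟩
    Group.ε G · x     ≈⟨ ε· x ⟩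
    x                 ∎

  ·-injective : ∀ g {x y} → g · x ≈ g · y → x ≈ y
  ·-injective g {x} {y} gx≈gy = begin
    x                 ≈⟨ ⁻¹·· g x ⟨
    (g ⁻¹) · (g · x)  ≈⟨ ·-congˡ (g ⁻¹) gx≈gy ⟩
    (g ⁻¹) · (g · y)  ≈⟨ ⁻¹·· g y ⟩
    y                 ∎

  ⁻¹∙· : ∀ {g h x y} → g · x ≈ h · y → (h ⁻¹ ∙ g) · x ≈ y
  ⁻¹∙· {g} {h} {x} {y} gx≈hy = begin
    (h ⁻¹ ∙ g) · x    ≈⟨ ∙· (h ⁻¹) g x ⟩
    (h ⁻¹) · (g · x)  ≈⟨ ·-congˡ (h ⁻¹) gx≈hy ⟩
    (h ⁻¹) · (h · y)  ≈⟨ ⁻¹·· h y ⟩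
    y                 ∎

  trivialStabilizers⇒free : TrivialStabilizers → ∀ {g h x} → g · x ≈ h · x → g ≈ᴳ h
  trivialStabilizers⇒free triv {g} {h} {x} gx≈hx = Group.trans G
    (inverseʳ-unique (h ⁻¹) g (triv x (h ⁻¹ ∙ g) (⁻¹∙· gx≈hx)))
    (⁻¹-involutive h)

-- Equivariant maps between sets with a group action.

module _ {G : Group a b} {X : Setoid c ℓ} {Y : Setoid d ℓ′}
         (A : Action G X) (B : Action G Y) (π : Func Y X) where
  private
    module G = Group G
    module X = Setoid X
    module Y = Setoid Y
    module A where
      open Action A public
      open ActionProperties A public
    module B where
      open Action B public
      open ActionProperties B public
    open Func π renaming (to to proj; cong to proj-cong)

  module _ (equivariant : ∀ g y → proj (g B.· y) X.≈ g A.· proj y) where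

    -- g moves o within its fibre {o , g·o}, hence swaps the two points; so once y
    -- and z have been carried into that fibre, either ε or g matches them.
    transitive-lift : Decidable Y._≈_ → (∀ x → AtMostTwo Y (λ y → proj y X.≈ x)) →
      A.Transitive → ∀ {g y} → g A.· proj y X.≈ proj y → ¬ g B.· y Y.≈ y → B.Transitive
    transitive-lift _≈?_ fibre transA {g} {o} fix moves y z
      with transA (proj y) (proj o) | transA (proj z) (proj o)
    ... | h , hy | h′ , hz = lifted
      where
      y′ = h B.· y
      z′ = h′ B.· z

      y′∈ : proj y′ X.≈ proj o
      y′∈ = X.trans (equivariant h y) hy

      z′∈ : proj z′ X.≈ proj o
      z′∈ = X.trans (equivariant h′ z) hz

      fixes : ∀ {w} → proj w X.≈ proj o → proj (g B.· w) X.≈ proj o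
      fixes {w} w∈ = X.trans (equivariant g w) (X.trans (A.·-congˡ g w∈) fix)

      -- A fixed `w` cannot be `o`, so it is the other point `g · o`; then `g · o ≈ g · w`, and
      -- injectivity of `g` gives `o ≈ w` after all.
      moves-fibre : ∀ {w} → proj w X.≈ proj o → ¬ g B.· w Y.≈ w
      moves-fibre {w} w∈ gw≈w = go≉w (Y.sym w≈go)
        where
        o≉w : ¬ o Y.≈ w
        o≉w o≈w = moves (Y.trans (B.·-congˡ g o≈w) (Y.trans gw≈w (Y.sym o≈w)))
        go≉w : ¬ g B.· o Y.≈ w
        go≉w go≈w = o≉w (B.·-injective g (Y.trans go≈w (Y.sym gw≈w)))
        w≈go : w Y.≈ g B.· o
        w≈go = fibre (proj o) X.refl w∈ (fixes X.refl) o≉w (moves ∘ Y.sym)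

      lifted : ∃ λ m → m B.· y Y.≈ z
      lifted with y′ ≈? z′
      ... | yes y′≈z′ = h′ G.⁻¹ G.∙ h , B.⁻¹∙· y′≈z′
      ... | no  y′≉z′ = h′ G.⁻¹ G.∙ (g G.∙ h) , B.⁻¹∙· (Y.trans (B.∙· g h y) (Y.sym
              (fibre (proj o) y′∈ z′∈ (fixes y′∈) y′≉z′ (moves-fibre y′∈ ∘ Y.sym))))

    -- Orbit-stabilizer with base point `o`: by regularity exactly one `g` carries `o` to a given
    -- `y`, and by equivariance it fixes `x` when `y` lies over `x`.
    stabilizer↔fibre : B.Regular → ∀ {x} → (∃ λ y → proj y X.≈ x) →
      Inverse (A.Stabilizer x) (Subsetoid Y (λ y → proj y X.≈ x))
    stabilizer↔fibre (transB , trivB) {x} (o , o∈) = record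
      { to        = λ (g , gx≈x) → g B.· o ,
                      X.trans (equivariant g o) (X.trans (A.·-congˡ g o∈) gx≈x)
      ; from      = λ (y , y∈) → proj₁ (transB o y) , stabilizes y∈ (proj₂ (transB o y))
      ; to-cong   = λ g≈h → B.·-cong g≈h Y.refl
      -- The element chosen by `transB` may depend on the representative of `y`; freeness removes
      -- this dependence.
      ; from-cong = λ {(y , _)} {(z , _)} y≈z → B.trivialStabilizers⇒free trivB
                      (Y.trans (proj₂ (transB o y)) (Y.trans y≈z (Y.sym (proj₂ (transB o z)))))
      ; inverse   = (λ {(y , _)} g≈ → Y.trans (B.·-cong g≈ Y.refl) (proj₂ (transB o y)))
                  , (λ {_} {(y , _)} y≈ → B.trivialStabilizers⇒free trivB
                      (Y.trans (proj₂ (transB o y)) y≈))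
      }
      where
      stabilizes : ∀ {y g} → proj y X.≈ x → g B.· o Y.≈ y → g A.· x X.≈ x
      stabilizes {y} {g} y∈ go≈y = begin
        g A.· x         ≈⟨ A.·-congˡ g o∈ ⟨
        g A.· proj o    ≈⟨ equivariant g o ⟨
        proj (g B.· o)  ≈⟨ proj-cong go≈y ⟩
        proj y          ≈⟨ y∈ ⟩
        x               ∎
        where open SetoidReasoning X

-- Counting functions between finite sets, and the two ends of a vector.

funToFin-cong : ∀ {m n} {f g : Fin m → Fin n} → f ≗ g → funToFin f ≡ funToFin g
funToFin-cong {zero}  f≗g = refl
funToFin-cong {suc m} f≗g = cong₂ combine (f≗g zero) (funToFin-cong (f≗g ∘ suc))

functions-cardinality : ∀ m n → HasCardinality (≋-setoid (setoid (Fin n)) m) (n ^ m)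
functions-cardinality m n = record
  { to        = funToFin
  ; from      = finToFun
  ; to-cong   = funToFin-cong
  ; from-cong = λ i≡j l → cong (λ i → finToFun i l) i≡j
  ; inverse   = (λ f≗ → trans (funToFin-cong f≗) (funToFin-finToFin {m} {n} _))
              , (λ { refl → finToFun-funToFin _ })
  }

_∷ʳ_ : {A : Set a} {n : ℕ} → Vector A n → A → Vector A (suc n)
xs ∷ʳ x = insertAt xs (fromℕ _) x

init-∷ʳ : {A : Set a} {n : ℕ} (xs : Vector A n) (x : A) → init (xs ∷ʳ x) ≗ xs
init-∷ʳ {n = suc n} xs x zero    = refl
init-∷ʳ {n = suc n} xs x (suc i) = init-∷ʳ (tail xs) x i

last-∷ʳ : {A : Set a} {n : ℕ} (xs : Vector A n) (x : A) → last (xs ∷ʳ x) ≡ x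
last-∷ʳ xs x = insertAt-lookup xs (fromℕ _) x

≗-init-last : {A : Set a} {n : ℕ} {xs ys : Vector A (suc n)} →
  init xs ≗ init ys → last xs ≡ last ys → xs ≗ ys
≗-init-last init≗ last≡ i with view i
... | ‵fromℕ     = last≡
... | ‵inject₁ j = init≗ j

≗-head-tail : {A : Set a} {n : ℕ} {xs ys : Vector A (suc n)} →
  head xs ≡ head ys → tail xs ≗ tail ys → xs ≗ ys
≗-head-tail head≡ tail≗ zero    = head≡
≗-head-tail head≡ tail≗ (suc i) = tail≗ i

-- Were there no such `n`, `P` would propagate from each number to the next and hold everywhere by
-- induction. With `P` as arc-transitivity this produces the exponent `k`.
last-true : {P : ℕ → Set ℓ} → ExcludedMiddle ℓ → P 0 → ¬ (∀ n → P n) → ∃ λ n → P n × ¬ P (suc n)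
last-true {P = P} em P0 ¬∀P = dne λ ¬∃ → ¬∀P (all ¬∃)
  where
  dne = em⇒dne em
  all : ¬ (∃ λ n → P n × ¬ P (suc n)) → ∀ n → P n
  all ¬∃ zero    = P0
  all ¬∃ (suc n) = dne λ ¬P → ¬∃ (n , all ¬∃ n , ¬P)

-- Arcs and their one-step extensions.

module _ (Γ : Digraph a ℓ) where
  open Digraph Γ
  open Automorphism using () renaming (to to _⟨$⟩_)

  private
    Arc : ℕ → Set (a ⊔ ℓ)
    Arc k = Setoid.Carrier (Arcs Γ k)

  headᵃ : ∀ k → Func (Arcs Γ k) (setoid V)
  headᵃ k = record { to = head ∘ proj₁ ; cong = λ x≈y → x≈y zero }

  initᵃ : ∀ k → Func (Arcs Γ (suc k)) (Arcs Γ k)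
  initᵃ k = record { to = λ (x , arc) → init x , arc ∘ inject₁ ; cong = λ x≈y → x≈y ∘ inject₁ }

  tailᵃ : ∀ k → Func (Arcs Γ (suc k)) (Arcs Γ k)
  tailᵃ k = record { to = λ (x , arc) → tail x , arc ∘ suc ; cong = λ x≈y → x≈y ∘ suc }

  ∷-isArc : ∀ {k u} {x : Vector V (suc k)} → E u (head x) → IsArc Γ k x → IsArc Γ (suc k) (u ∷ x)
  ∷-isArc u→x arc zero    = u→x
  ∷-isArc u→x arc (suc i) = arc i

  ∷ʳ-isArc : ∀ {k w} {x : Vector V (suc k)} → IsArc Γ k x → E (last x) w → IsArc Γ (suc k) (x ∷ʳ w)
  ∷ʳ-isArc {zero}  arc x→w zero    = x→w
  ∷ʳ-isArc {suc k} arc x→w zero    = arc zero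
  ∷ʳ-isArc {suc k} arc x→w (suc i) = ∷ʳ-isArc (arc ∘ suc) x→w i

  -- An extension of `x` at its end is determined by its last vertex, an out-neighbour of `last x`,
  -- so the bound on out-neighbours carries over.
  init-fibre : ∀ {k} → (∀ v → AtMostTwo (setoid V) (E v)) →
    ∀ (x : Arc k) → AtMostTwo (Arcs Γ (suc k)) (λ y → init (proj₁ y) ≗ proj₁ x)
  init-fibre {k} out (x , _) {y₁} {y₂} {y₃} p₁ p₂ p₃ y₁≉y₂ y₁≉y₃ =
    equal y₂ y₃ p₂ p₃ (out (last x) (to-last y₁ p₁) (to-last y₂ p₂) (to-last y₃ p₃)
      (λ l → y₁≉y₂ (equal y₁ y₂ p₁ p₂ l)) (λ l → y₁≉y₃ (equal y₁ y₃ p₁ p₃ l)))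
    where
    equal : ∀ ((y , _) (z , _) : Arc (suc k)) → init y ≗ x → init z ≗ x → last y ≡ last z → y ≗ z
    equal _ _ p q = ≗-init-last (λ i → trans (p i) (sym (q i)))

    to-last : ∀ ((y , _) : Arc (suc k)) → init y ≗ x → E (last x) (last y)
    to-last (y , arc) p = subst (λ v → E v (last y)) (p (fromℕ k)) (arc (fromℕ k))

  tail-fibre : ∀ {k} → (∀ v → AtMostTwo (setoid V) (λ u → E u v)) →
    ∀ (x : Arc k) → AtMostTwo (Arcs Γ (suc k)) (λ y → tail (proj₁ y) ≗ proj₁ x)
  tail-fibre {k} inn (x , _) {y₁} {y₂} {y₃} p₁ p₂ p₃ y₁≉y₂ y₁≉y₃ =
    equal y₂ y₃ p₂ p₃ (inn (head x) (from-head y₁ p₁) (from-head y₂ p₂) (from-head y₃ p₃)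
      (λ h → y₁≉y₂ (equal y₁ y₂ p₁ p₂ h)) (λ h → y₁≉y₃ (equal y₁ y₃ p₁ p₃ h)))
    where
    equal : ∀ ((y , _) (z , _) : Arc (suc k)) → tail y ≗ x → tail z ≗ x → head y ≡ head z → y ≗ z
    equal _ _ p q h = ≗-head-tail h (λ i → trans (p i) (sym (q i)))

    from-head : ∀ ((y , _) : Arc (suc k)) → tail y ≗ x → E (head y) (head x)
    from-head (y , arc) p = subst (E (head y)) (p zero) (arc zero)

  -- Counting the arcs that start at a given vertex.

  module _ {m : ℕ} (out : ∀ v → OutValency Γ v m) where

    index : ∀ {u v} → E u v → Fin m
    index {u} {v} u→v = Inverse.to (out u) (v , u→v)

    -- Out-neighbours are compared as vertices, so the number of an edge ignores its proof; this
    -- lets the encoding respect equality of arcs.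
    index-cong : ∀ {u u′ v v′} {e : E u v} {e′ : E u′ v′} → u ≡ u′ → v ≡ v′ → index e ≡ index e′
    index-cong {u} refl v≡v′ = Inverse.to-cong (out u) v≡v′

    -- Decodes a word: each letter of `c` selects the next vertex by its number among the
    -- out-neighbours of the current one.
    walk : ∀ {k} → V → Vector (Fin m) k → Vector V (suc k)
    walk         v c zero    = v
    walk {suc k} v c (suc i) = walk (proj₁ (Inverse.from (out v) (c zero))) (tail c) i

    walk-isArc : ∀ {k} v (c : Vector (Fin m) k) → IsArc Γ k (walk v c)
    walk-isArc {suc k} v c zero    = proj₂ (Inverse.from (out v) (c zero))
    walk-isArc {suc k} v c (suc i) = walk-isArc _ (tail c) i

    walk-cong : ∀ {k} v {c d : Vector (Fin m) k} → c ≗ d → walk v c ≗ walk v d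
    walk-cong         v         c≗d zero    = refl
    walk-cong {suc k} v {c} {d} c≗d (suc i) = trans
      (walk-cong _ (c≗d ∘ suc) i)
      (cong (λ j → walk (proj₁ (Inverse.from (out v) j)) (tail d) i) (c≗d zero))

    index-walk : ∀ {k} v (c : Vector (Fin m) k) → (λ i → index (walk-isArc v c i)) ≗ c
    index-walk {suc k} v c zero    = Inverse.strictlyInverseˡ (out v) (c zero)
    index-walk {suc k} v c (suc i) = index-walk _ (tail c) i

    -- The start is given only up to `head x ≡ v` because the recursive call starts at a decoded
    -- out-neighbour, which equals the next vertex of `x` by `strictlyInverseʳ` and not by
    -- computation.
    walk-index : ∀ {k v} {x : Vector V (suc k)} (arc : IsArc Γ k x) → head x ≡ v →
      walk v (λ i → index (arc i)) ≗ x
    walk-index         arc x₀≡v zero    = sym x₀≡v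
    walk-index {suc k} arc refl (suc i) = walk-index (arc ∘ suc)
      (sym (Inverse.strictlyInverseʳ (out _) (_ , arc zero))) i

    arcs-from-cardinality : ∀ k v →
      HasCardinality (Subsetoid (Arcs Γ k) (λ x → head (proj₁ x) ≡ v)) (m ^ k)
    arcs-from-cardinality k v = Compose.inverse codes (functions-cardinality k m)
      where
      codes : Inverse (Subsetoid (Arcs Γ k) (λ x → head (proj₁ x) ≡ v)) (≋-setoid (setoid (Fin m)) k)
      codes = record
        { to        = λ ((_ , arc) , _) i → index (arc i)
        ; from      = λ c → (walk v c , walk-isArc v c) , refl
        ; to-cong   = λ x≈y i → index-cong (x≈y (inject₁ i)) (x≈y (suc i))
        ; from-cong = walk-cong v
        ; inverse   = (λ {c} x≈ i → trans (index-cong (x≈ (inject₁ i)) (x≈ (suc i))) (index-walk v c i))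
                    , (λ {((_ , arc) , x₀≡v)} c≈ i →
                         trans (walk-cong v c≈ i) (walk-index arc x₀≡v i))
        }

  -- Regularity on arcs of the critical length.

  module _ (em : ExcludedMiddle (a ⊔ ℓ)) (connected : Connected Γ)
           (inn : ∀ v → InValency Γ v 2) (out : ∀ v → OutValency Γ v 2)
           {k : ℕ} (k-trans : ArcTransitive Γ k) (¬k+1-trans : ¬ ArcTransitive Γ (suc k)) where
    private
      -- Equality of arcs lives at level `a`; lifting it to `a ⊔ ℓ` brings it within reach of `em`.
      em′ : ExcludedMiddle a
      em′ = map′ lower lift (em {Lift ℓ _})

    -- If `g` moved `y`, `transitive-lift` along `initᵃ` would contradict `¬k+1-trans`.
    stabilizer-fixes-snoc : ∀ g (y : Arc (suc k)) →
      (∀ i → g ⟨$⟩ init (proj₁ y) i ≡ init (proj₁ y) i) → ∀ i → g ⟨$⟩ proj₁ y i ≡ proj₁ y i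
    stabilizer-fixes-snoc g y fix = em⇒dne em′ λ moves → ¬k+1-trans
      (transitive-lift (arcAction Γ k) (arcAction Γ (suc k)) (initᵃ k) (λ _ _ _ → refl) (λ _ _ → em′)
        (init-fibre (λ v → cardinality-2⇒AtMostTwo {P = E v} (out v))) k-trans {g} {y} fix moves)

    stabilizer-fixes-cons : ∀ g (y : Arc (suc k)) →
      (∀ i → g ⟨$⟩ tail (proj₁ y) i ≡ tail (proj₁ y) i) → ∀ i → g ⟨$⟩ proj₁ y i ≡ proj₁ y i
    stabilizer-fixes-cons g y fix = em⇒dne em′ λ moves → ¬k+1-trans
      (transitive-lift (arcAction Γ k) (arcAction Γ (suc k)) (tailᵃ k) (λ _ _ _ → refl) (λ _ _ → em′)
        (tail-fibre (λ v → cardinality-2⇒AtMostTwo {P = λ u → E u v} (inn v))) k-trans {g} {y} fix moves)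

    module _ (g : Automorphism Γ) where

      -- The invariant spread over the digraph. The position is recorded because in-neighbours are
      -- reached from the first vertex of a fixed arc and out-neighbours from the last.
      OnFixedArc : Fin (suc k) → V → Set (a ⊔ ℓ)
      OnFixedArc i v = ∃ λ ((x , _) : Arc k) → (∀ j → g ⟨$⟩ x j ≡ x j) × x i ≡ v

      fixed-snoc : ∀ ((x , _) : Arc k) → (∀ j → g ⟨$⟩ x j ≡ x j) → ∀ {w} → E (last x) w →
        ∀ j → g ⟨$⟩ (x ∷ʳ w) j ≡ (x ∷ʳ w) j
      fixed-snoc (x , arc) fix {w} x→w = stabilizer-fixes-snoc g (x ∷ʳ w , ∷ʳ-isArc arc x→w)
        λ j → subst (λ v → g ⟨$⟩ v ≡ v) (sym (init-∷ʳ x w j)) (fix j)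

      fixed-cons : ∀ ((x , _) : Arc k) → (∀ j → g ⟨$⟩ x j ≡ x j) → ∀ {u} → E u (head x) →
        ∀ j → g ⟨$⟩ (u ∷ x) j ≡ (u ∷ x) j
      fixed-cons (x , arc) fix {u} u→x = stabilizer-fixes-cons g (u ∷ x , ∷-isArc u→x arc) fix

      predecessor : ∀ {u v} → E u v → OnFixedArc zero v → OnFixedArc zero u
      predecessor u→v ((x , arc) , fix , refl) =
        -- Prepending `u` gives a fixed arc one step too long; composing with `inject₁` drops its
        -- last vertex.
        (_ , ∷-isArc {x = x} u→v arc ∘ inject₁) , fixed-cons (x , arc) fix u→v ∘ inject₁ , refl

      successor : ∀ {v w} → E v w → OnFixedArc (fromℕ k) v → OnFixedArc (fromℕ k) w
      successor {w = w} v→w ((x , arc) , fix , refl) =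
        (_ , ∷ʳ-isArc {x = x} arc v→w ∘ suc) , fixed-snoc (x , arc) fix v→w ∘ suc , last-∷ʳ x w

      -- Prepending a vertex and dropping the last one pushes `v` one place towards the end. Any
      -- in-neighbour of the head serves; the one numbered `zero` is taken.
      shift-back : ∀ {v} i → OnFixedArc (inject₁ i) v → OnFixedArc (suc i) v
      shift-back i ((x , arc) , fix , xᵢ≡v) with Inverse.from (inn (head x)) zero
      ... | u , u→x = (_ , ∷-isArc {x = x} u→x arc ∘ inject₁) , fixed-cons (x , arc) fix u→x ∘ inject₁ , xᵢ≡v

      shift-forward : ∀ {v} i → OnFixedArc (suc i) v → OnFixedArc (inject₁ i) v
      shift-forward i ((x , arc) , fix , xᵢ≡v) with Inverse.from (out (last x)) zero
      ... | w , x→w = (_ , ∷ʳ-isArc {x = x} arc x→w ∘ suc) , fixed-snoc (x , arc) fix x→w ∘ suc ,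
                      trans (init-∷ʳ x w (suc i)) xᵢ≡v

      last⇒first : ∀ {v} → OnFixedArc (fromℕ k) v → OnFixedArc zero v
      last⇒first p = >-weakInduction (λ i → OnFixedArc i _) p shift-forward zero

      first⇒last : ∀ {v} → OnFixedArc zero v → OnFixedArc (fromℕ k) v
      first⇒last p = <-weakInduction (λ i → OnFixedArc i _) p shift-back (fromℕ k)

      -- Position `zero` is restored after each edge. Against an edge, prepending suffices; along an
      -- edge, the vertex is first shifted to the last position, the next vertex is appended, and
      -- that one is shifted back.
      onFixedArc-connected : ∀ {u v} → EqClosure E u v → OnFixedArc zero u → OnFixedArc zero v
      onFixedArc-connected ε              p = p
      onFixedArc-connected (fwd u→w ◅ ws) p =
        onFixedArc-connected ws (last⇒first (successor u→w (first⇒last p)))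
      onFixedArc-connected (bwd w→u ◅ ws) p = onFixedArc-connected ws (predecessor w→u p)

    trivialStabilizers : Action.TrivialStabilizers (arcAction Γ k)
    trivialStabilizers x g fix v
      -- Equality with the identity is checked at each `v`, starting from the head of the fixed arc
      -- `x` itself.
      with onFixedArc-connected g (connected (head (proj₁ x)) v) (x , fix , refl)
    ... | _ , fix′ , refl = fix′ zero

    arcRegular : ArcRegular Γ k
    arcRegular = k-trans , trivialStabilizers

    vertexStabilizer-cardinality : ∀ v → HasCardinality (VertexStabilizer Γ v) (2 ^ k)
    vertexStabilizer-cardinality v = Compose.inverse
      (stabilizer↔fibre (vertexAction Γ) (arcAction Γ k) (headᵃ k) (λ _ _ → refl) arcRegular
        (Inverse.from arcs zero-code))
      arcs
      where
      arcs = arcs-from-cardinality out k v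
      -- The base point for `stabilizer↔fibre`: the walk from `v` that always takes the
      -- out-neighbour numbered `zero`.
      zero-code = funToFin {k} {2} (λ _ → zero)

proposition6 : ∀ {a ℓ : Level} → ExcludedMiddle (a ⊔ ℓ) →
    (Γ : Digraph a ℓ) →
    Connected Γ → VertexTransitive Γ →
    (∀ v → InValency Γ v 2) → (∀ v → OutValency Γ v 2) →
    (¬ HighlyArcTransitive Γ →
    ∃ λ (k : ℕ) → ArcRegular Γ k ×
    (∀ v → HasCardinality (VertexStabilizer Γ v) (2 ^ k)))
    × ((∀ v → Infinite (VertexStabilizer Γ v)) → HighlyArcTransitive Γ)
proposition6 {a} {ℓ} em Γ connected vtrans inn out = regular , infinite⇒hat
  where
  regular : ¬ HighlyArcTransitive Γ →
    ∃ λ k → ArcRegular Γ k × (∀ v → HasCardinality (VertexStabilizer Γ v) (2 ^ k))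
  regular ¬hat with last-true em 0-trans ¬hat
    where
    -- A 0-arc is a vertex, so vertex-transitivity starts the search for `k`.
    0-trans : ArcTransitive Γ 0
    0-trans (x , _) (y , _) with vtrans (x zero) (y zero)
    ... | g , gx≡y = g , λ { zero → gx≡y }
  ... | k , k-trans , ¬k+1-trans =
    k , arcRegular Γ em connected inn out k-trans ¬k+1-trans
      , vertexStabilizer-cardinality Γ em connected inn out k-trans ¬k+1-trans

  infinite⇒hat : (∀ v → Infinite (VertexStabilizer Γ v)) → HighlyArcTransitive Γ
  infinite⇒hat inf with em {HighlyArcTransitive Γ}
  ... | yes hat = hat
  -- The arc to be moved supplies a vertex `x zero`, whose stabilizer would be both finite and
  -- infinite.
  ... | no ¬hat = λ _ (x , _) _ →
    let k , _ , card = regular ¬hat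
    in contradiction (2 ^ k , card (x zero)) (inf (x zero))
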